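{- Let $G$ and $H$ be two vertex-disjoint graphs, considered as starting positions of the Maker-Breaker domination game, and let $G\bowtie H$ denote their join (the union of $G$ and $H$ together with all edges $uv$ with $u\in V(G)$, $v\in V(H)$). (i) If $G=K_1$ and $o(H)=\mathcal S$ (or $H=K_1$ and $o(G)=\mathcal S$), then $o(G\bowtie H)=\mathcal N$. (ii) Otherwise, $o(G\bowtie H)=\mathcal D$.
   Context: The Maker-Breaker domination game on a graph: Dominator and Staller alternately choose a not-yet-chosen vertex (no passing), starting with all vertices unchosen; when all vertices are chosen, Dominator wins if his vertices form a dominating set of the graph, otherwise Staller wins. The outcome $o(\cdot)$ is $\mathcal D$ if Dominator has a winning strategy both as first and as second player, $\mathcal S$ if Staller has a winning strategy both as first and as second player, and $\mathcal N$ if the first player has a winning strategy; every graph has one of these three outcomes. $K_1$ is the graph with a single vertex. -}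

module Defs where

open import Data.Empty using (⊥)
open import Data.Fin using (Fin; splitAt)
open import Data.Maybe using (Maybe; just; nothing)
open import Data.Nat using (ℕ; suc; _+_; NonZero)
open import Data.Product using (Σ; ∃; _×_; _,_)
open import Data.Sum using (_⊎_; inj₁; inj₂)
open import Data.Unit using (⊤; tt)
open import Data.Vec using (Vec; lookup; replicate; _[_]≔_)
open import Function.Bundles using (_↔_; _⇔_; Inverse)
open import Level using (0ℓ)
open import Relation.Binary.Core using (Rel)
open import Relation.Binary.Definitions using (Decidable; Symmetric; Irreflexive)
open import Relation.Binary.PropositionalEquality using (_≡_; refl)
open import Relation.Nullary using (¬_; yes; no)
open import Relation.Unary using (Pred)

-- Finite simple graphs with at least one vertex.  The null graph has to be
-- excluded: its join with H is H, whose outcome is arbitrary.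
record Graph : Set₁ where
  field
    order    : ℕ
    nonEmpty : NonZero order
    Adj      : Rel (Fin order) 0ℓ
    adj?     : Decidable Adj
    symm     : Symmetric Adj
    irrefl   : Irreflexive _≡_ Adj

  Vertex : Set
  Vertex = Fin order

open Graph using (order; Vertex; Adj)

record _≅_ (G H : Graph) : Set where
  field
    bijection : Vertex G ↔ Vertex H
    adjacency : ∀ u v →
      Adj G u v ⇔ Adj H (Inverse.to bijection u) (Inverse.to bijection v)

K₁ : Graph
K₁ = record
  { order    = 1
  ; nonEmpty = _
  ; Adj      = λ _ _ → ⊥
  ; adj?     = λ _ _ → no λ ()
  ; symm     = λ ()
  ; irrefl   = λ _ ()
  }

module Join (G H : Graph) where
  private
    module G = Graph G
    module H = Graph H

  Adj⊎ : Rel (G.Vertex ⊎ H.Vertex) 0ℓ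
  Adj⊎ (inj₁ u) (inj₁ v) = G.Adj u v
  Adj⊎ (inj₁ _) (inj₂ _) = ⊤
  Adj⊎ (inj₂ _) (inj₁ _) = ⊤
  Adj⊎ (inj₂ u) (inj₂ v) = H.Adj u v

  adj⊎? : Decidable Adj⊎
  adj⊎? (inj₁ u) (inj₁ v) = G.adj? u v
  adj⊎? (inj₁ _) (inj₂ _) = yes tt
  adj⊎? (inj₂ _) (inj₁ _) = yes tt
  adj⊎? (inj₂ u) (inj₂ v) = H.adj? u v

  symm⊎ : ∀ x y → Adj⊎ x y → Adj⊎ y x
  symm⊎ (inj₁ _) (inj₁ _) = G.symm
  symm⊎ (inj₁ _) (inj₂ _) = λ _ → tt
  symm⊎ (inj₂ _) (inj₁ _) = λ _ → tt
  symm⊎ (inj₂ _) (inj₂ _) = H.symm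

  irrefl⊎ : ∀ x → ¬ Adj⊎ x x
  irrefl⊎ (inj₁ _) = G.irrefl refl
  irrefl⊎ (inj₂ _) = H.irrefl refl

  nonEmpty+ : ∀ m n → NonZero m → NonZero (m + n)
  nonEmpty+ (suc _) _ _ = _

-- The vertices of G ⋈ H are those of the disjoint union: splitAt identifies
-- Fin (order G + order H) with Vertex G ⊎ Vertex H.
infixr 6 _⋈_
_⋈_ : Graph → Graph → Graph
G ⋈ H = record
  { order    = order G + order H
  ; nonEmpty = nonEmpty+ (order G) (order H) (Graph.nonEmpty G)
  ; Adj      = λ u v → Adj⊎ (side u) (side v)
  ; adj?     = λ u v → adj⊎? (side u) (side v)
  ; symm     = λ {u} {v} → symm⊎ (side u) (side v)
  ; irrefl   = λ { {u} refl → irrefl⊎ (side u) }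
  }
  where
  open Join G H
  side : Fin (order G + order H) → Vertex G ⊎ Vertex H
  side = splitAt (order G)

Dominating : (G : Graph) → Pred (Vertex G) 0ℓ → Set
Dominating G S = ∀ v → S v ⊎ ∃ λ u → S u × Adj G u v

data Player : Set where
  dominator staller : Player

opponent : Player → Player
opponent dominator = staller
opponent staller   = dominator

-- `first`: the player under consideration makes the next move;
-- `second`: the opponent does.
data Role : Set where
  first second : Role

-- The owner of each vertex, with `nothing` for a vertex not yet chosen.
Position : Graph → Set
Position G = Vec (Maybe Player) (order G)

start : (G : Graph) → Position G
start G = replicate (order G) nothing

module Game (G : Graph) where

  Unchosen : Position G → Pred (Vertex G) 0ℓ
  Unchosen p v = lookup p v ≡ nothing

  Finished : Position G → Set
  Finished p = ∀ v → ¬ Unchosen p v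

  ChosenBy : Player → Position G → Pred (Vertex G) 0ℓ
  ChosenBy P p v = lookup p v ≡ just P

  choose : Player → Vertex G → Position G → Position G
  choose P v p = p [ v ]≔ just P

  -- Meaningful at finished positions only.
  Won : Player → Position G → Set
  Won dominator p = Dominating G (ChosenBy dominator p)
  Won staller   p = ¬ Dominating G (ChosenBy dominator p)

  -- A strategy of P in extensive form: it selects one legal move whenever P is
  -- to move and provides a continuation for every legal move of the opponent,
  -- until all vertices are chosen.
  data Strategy (P : Player) : Role → Position G → Set where
    finished : ∀ {r p} → Finished p → Strategy P r p
    move     : ∀ {p} v → Unchosen p v →
               Strategy P second (choose P v p) → Strategy P first p
    answer   : ∀ {p} → ∃ (Unchosen p) →
               (∀ v → Unchosen p v →
                 Strategy P first (choose (opponent P) v p)) →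
               Strategy P second p

  -- Every play consistent with the strategy ends in a position won by P.
  Winning : ∀ {P r p} → Strategy P r p → Set
  Winning {P} {p = p} (finished _) = Won P p
  Winning (move _ _ σ)             = Winning σ
  Winning {p = p} (answer _ σ)     = ∀ v (u : Unchosen p v) → Winning (σ v u)

  HasWinningStrategy : Player → Role → Set
  HasWinningStrategy P r = Σ (Strategy P r (start G)) Winning

open Game using (HasWinningStrategy)

data Outcome : Set where
  𝒟 𝒮 𝒩 : Outcome

HasOutcome : Graph → Outcome → Set
HasOutcome G 𝒟 = HasWinningStrategy G dominator first × HasWinningStrategy G dominator second
HasOutcome G 𝒮 = HasWinningStrategy G staller first × HasWinningStrategy G staller second
HasOutcome G 𝒩 = HasWinningStrategy G dominator first × HasWinningStrategy G staller first

{-# OPTIONS --safe #-}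

-- If both graphs have at least two vertices, Dominator can secure a vertex in
-- each of them, and two such vertices dominate the join.  If one graph is K₁,
-- its vertex is an apex dominating the whole join: Dominator wins as soon as he
-- gets it, so Staller has to open with it, and what remains is the game on the
-- other graph H with Dominator to move.  By determinacy and the fact that an
-- extra move never harms Staller, Dominator wins that game unless o(H) = 𝒮.
module Submission where

open import Defs
open import Data.Bool using (Bool; true; false; not)
open import Data.Bool.Properties using (not-¬) renaming (_≟_ to _≟ᵇ_)
open import Data.Empty using (⊥-elim)
open import Data.Fin using (Fin; zero; suc; splitAt; _↑ˡ_; _↑ʳ_)
open import Data.Fin.Properties using (_≟_; any?; all?; splitAt-↑ˡ; splitAt-↑ʳ; splitAt⁻¹-↑ˡ; splitAt⁻¹-↑ʳ; ↑ˡ-injective; ↑ʳ-injective)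
open import Data.Maybe using (Maybe; just; nothing)
open import Data.Maybe.Properties using (≡-dec)
open import Data.Nat using (ℕ; zero; suc; _<_; s≤s)
open import Data.Nat.Induction using (<-wellFounded)
open import Data.Nat.Properties using (≤-refl)
open import Data.Product using (Σ; ∃; ∃₂; _×_; _,_; proj₁; proj₂)
open import Data.Sum using (_⊎_; inj₁; inj₂; swap)
import Data.Sum as Sum
open import Data.Unit using (tt)
open import Data.Vec using (Vec; _∷_; lookup; _[_]≔_)
open import Data.Vec.Properties using (lookup∘update; lookup∘update′; lookup-replicate; []≔-commutes)
open import Function.Base using (_∘_)
open import Function.Bundles using (_⇔_; mk⇔; mk↔ₛ′; Inverse; Equivalence)
open import Function.Construct.Identity using (⇔-id)
open import Induction.WellFounded using (Acc; acc)
open import Relation.Binary.Definitions using (DecidableEquality)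
open import Relation.Binary.PropositionalEquality using (_≡_; _≢_; refl; sym; trans; cong; subst; ≢-sym)
open import Relation.Nullary using (¬_; Dec; yes; no; contradiction)
open import Relation.Nullary.Decidable using (_×-dec_; _⊎-dec_)

open Graph using (order; Vertex; Adj; adj?; symm; irrefl)

-- Players, a termination measure and finite search.

_≟ᴾ_ : DecidableEquality Player
dominator ≟ᴾ dominator = yes refl
dominator ≟ᴾ staller   = no λ ()
staller   ≟ᴾ dominator = no λ ()
staller   ≟ᴾ staller   = yes refl

opponent-involutive : ∀ P → opponent (opponent P) ≡ P
opponent-involutive dominator = refl
opponent-involutive staller   = refl

-- Termination measure for play: a move updates the position, so recursion along a play is not
-- structural, but every legal move lowers this count.
#nothing : ∀ {A : Set} {n} → Vec (Maybe A) n → ℕ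
#nothing Vec.[]         = 0
#nothing (nothing ∷ xs) = suc (#nothing xs)
#nothing (just _ ∷ xs)  = #nothing xs

#nothing-[]≔just : ∀ {A : Set} {n} (xs : Vec (Maybe A) n) i {x} →
  lookup xs i ≡ nothing → #nothing (xs [ i ]≔ just x) < #nothing xs
#nothing-[]≔just (nothing ∷ xs) zero    _  = ≤-refl
#nothing-[]≔just (nothing ∷ xs) (suc i) eq = s≤s (#nothing-[]≔just xs i eq)
#nothing-[]≔just (just _ ∷ xs)  (suc i) eq = #nothing-[]≔just xs i eq

-- The constructive core of backward induction: with `A` as "this move wins" and `B` as "this move
-- is refuted", pointwise alternatives give either a winning move or a refutation of all moves.
find-or-all : ∀ {n} {U A B : Fin n → Set} → (∀ i → Dec (U i)) →
  (∀ i → U i → A i ⊎ B i) → (∃ λ i → U i × A i) ⊎ (∀ i → U i → B i)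
find-or-all {zero}  U? f = inj₂ λ ()
find-or-all {suc n} U? f with find-or-all (U? ∘ suc) (f ∘ suc)
... | inj₁ (i , u , a) = inj₁ (suc i , u , a)
... | inj₂ b with U? zero
...   | no ¬u = inj₂ λ { zero u → contradiction u ¬u ; (suc i) → b i }
...   | yes u with f zero u
...     | inj₁ a  = inj₁ (zero , u , a)
...     | inj₂ b₀ = inj₂ λ { zero _ → b₀ ; (suc i) → b i }

-- The game on one graph: determinacy and monotonicity.

module Play (G : Graph) where
  open Game G public

  -- A strategy together with the proof that it wins, as one inductive family.
  data Win (P : Player) : Role → Position G → Set where
    finished : ∀ {r p} → Finished p → Won P p → Win P r p
    move     : ∀ {p} v → Unchosen p v →
               Win P second (choose P v p) → Win P first p
    answer   : ∀ {p} → ∃ (Unchosen p) →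
               (∀ v → Unchosen p v → Win P first (choose (opponent P) v p)) →
               Win P second p

  toStrategy : ∀ {P r p} → Win P r p → Σ (Strategy P r p) Winning
  toStrategy (finished f w) = finished f , w
  toStrategy (move v u w)   = let (σ , win) = toStrategy w in move v u σ , win
  toStrategy (answer e k)   =
    answer e (λ v u → proj₁ (toStrategy (k v u))) , λ v u → proj₂ (toStrategy (k v u))

  fromStrategy : ∀ {P r p} (σ : Strategy P r p) → Winning σ → Win P r p
  fromStrategy (finished f) w = finished f w
  fromStrategy (move v u σ) w = move v u (fromStrategy σ w)
  fromStrategy (answer e k) w = answer e λ v u → fromStrategy (k v u) (w v u)

  unchosen? : ∀ p v → Dec (Unchosen p v)
  unchosen? p v = ≡-dec _≟ᴾ_ (lookup p v) nothing

  unchosen-start : ∀ v → Unchosen (start G) v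
  unchosen-start v = lookup-replicate v nothing

  chosen : ∀ P v p → ChosenBy P (choose P v p) v
  chosen P v p = lookup∘update v p (just P)

  choose-≢ : ∀ {P v w x} p → w ≢ v → lookup p w ≡ x → lookup (choose P v p) w ≡ x
  choose-≢ p w≢v eq = trans (lookup∘update′ w≢v p _) eq

  choose-keeps : ∀ {P Q v w} p → Unchosen p v → ChosenBy Q p w → ChosenBy Q (choose P v p) w
  choose-keeps p u c = choose-≢ p (λ { refl → contradiction (trans (sym u) c) λ () }) c

  unchosen-choose⁻ : ∀ {P v w} p → Unchosen (choose P v p) w → w ≢ v × Unchosen p w
  unchosen-choose⁻ {P} {v} {w} p u = w≢v , trans (sym (lookup∘update′ w≢v p _)) u
    where
    w≢v : w ≢ v
    w≢v refl = contradiction (trans (sym u) (chosen P v p)) λ ()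

  finished? : ∀ p → ∃ (Unchosen p) ⊎ Finished p
  finished? p with any? (unchosen? p)
  ... | yes e = inj₁ e
  ... | no ¬e = inj₂ λ v u → ¬e (v , u)

  win⇒won : ∀ {P r p} → Finished p → Win P r p → Won P p
  win⇒won f (finished _ w)       = w
  win⇒won f (move v u _)         = ⊥-elim (f v u)
  win⇒won f (answer (v , u) _)   = ⊥-elim (f v u)

  dominating-⊆ : ∀ {S T : Vertex G → Set} → (∀ {v} → S v → T v) →
    Dominating G S → Dominating G T
  dominating-⊆ S⊆T d v = Sum.map S⊆T (λ (u , s , a) → u , S⊆T s , a) (d v)

  dominating? : ∀ p → Dec (Dominating G (ChosenBy dominator p))
  dominating? p = all? λ v → mine? v ⊎-dec any? λ u → mine? u ×-dec adj? G u v
    where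
    mine? : ∀ v → Dec (ChosenBy dominator p v)
    mine? v = ≡-dec _≟ᴾ_ (lookup p v) (just dominator)

  won-or-lost : ∀ P p → Won P p ⊎ Won (opponent P) p
  won-or-lost P p with dominating? p
  won-or-lost dominator p | yes d = inj₁ d
  won-or-lost dominator p | no ¬d = inj₂ ¬d
  won-or-lost staller   p | yes d = inj₂ d
  won-or-lost staller   p | no ¬d = inj₁ ¬d

  -- Backward induction on the number of unchosen vertices. At finished positions the alternative is
  -- decided because domination is decidable.
  determined : ∀ P p → Win P first p ⊎ Win (opponent P) second p
  determined P p = go P p (<-wellFounded _)
    where
    go : ∀ P p → Acc _<_ (#nothing p) → Win P first p ⊎ Win (opponent P) second p
    go P p (acc rs) with finished? p
    ... | inj₂ f = Sum.map (finished f) (finished f) (won-or-lost P p)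
    ... | inj₁ e = Sum.map (λ (v , u , w) → move v u w) (answer e) (find-or-all (unchosen? p) step)
      where
      step : ∀ v → Unchosen p v → Win P second (choose P v p) ⊎
        Win (opponent P) first (choose (opponent (opponent P)) v p)
      step v u with go (opponent P) (choose P v p) (rs (#nothing-[]≔just p v u))
      -- The recursive call takes the view of `opponent P`, who is now to move, so its alternatives
      -- come in the opposite order and mention the opponent of the opponent.
      ... | r rewrite opponent-involutive P = swap r

  -- Dominator never loses a vertex, so domination persists and he may play arbitrary moves until
  -- the end.
  dominating⇒win : ∀ r p → Dominating G (ChosenBy dominator p) → Win dominator r p
  dominating⇒win r p = go r p (<-wellFounded _)
    where
    go : ∀ r p → Acc _<_ (#nothing p) → Dominating G (ChosenBy dominator p) → Win dominator r p
    go r p (acc rs) d with finished? p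
    go r      p (acc rs) d | inj₂ f = finished f d
    go first  p (acc rs) d | inj₁ (v , u) =
      move v u (go second _ (rs (#nothing-[]≔just p v u)) (dominating-⊆ (choose-keeps p u) d))
    go second p (acc rs) d | inj₁ e =
      answer e λ v u → go first _ (rs (#nothing-[]≔just p v u)) (dominating-⊆ (choose-keeps p u) d)

  -- Staller plays on as if the extra vertex v were free; when the strategy asks
  -- for v, she takes an arbitrary vertex, which becomes the new extra one.
  mutual
    second⇒first : ∀ {p} → Win staller second p → Win staller first p
    second⇒first (finished f w)         = finished f w
    second⇒first w@(answer (v , u) _)   = move v u (extra-second w v u)

    extra-second : ∀ {p} → Win staller second p → ∀ v → Unchosen p v →
      Win staller second (choose staller v p)
    extra-second (finished f _) v u = ⊥-elim (f v u)
    extra-second {p} (answer e k) v u with finished? (choose staller v p)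
    -- Here `v` was the last unchosen vertex. The given strategy already wins when Dominator gets
    -- `v`; with `v` in Staller's hands his set is only smaller.
    ... | inj₂ f = finished f λ d → win⇒won f′ (k v u) (dominating-⊆ S⊆D d)
      where
      f′ : Finished (choose dominator v p)
      f′ w uw = let (w≢v , uw′) = unchosen-choose⁻ p uw in f w (choose-≢ p w≢v uw′)
      S⊆D : ∀ {w} → ChosenBy dominator (choose staller v p) w →
            ChosenBy dominator (choose dominator v p) w
      S⊆D {w} c with w ≟ v
      ... | yes refl = chosen dominator v p
      ... | no w≢v   = choose-≢ p w≢v (trans (sym (lookup∘update′ w≢v p _)) c)
    ... | inj₁ e′ = answer e′ λ w uw →
      let (w≢v , uw′) = unchosen-choose⁻ p uw in
      subst (Win staller first) ([]≔-commutes p w v w≢v)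
        (extra-first (k w uw′) v (choose-≢ p (≢-sym w≢v) u))

    extra-first : ∀ {p} → Win staller first p → ∀ v → Unchosen p v →
      Win staller first (choose staller v p)
    extra-first (finished f _) v u = ⊥-elim (f v u)
    extra-first {p} (move x ux w) v u with x ≟ v
    ... | yes refl = second⇒first w
    ... | no x≢v   = move x (choose-≢ p x≢v ux)
      (subst (Win staller second) ([]≔-commutes p x v x≢v)
        (extra-second w v (choose-≢ p (≢-sym x≢v) u)))

  ¬𝒮⇒dominator-first : ¬ HasOutcome G 𝒮 → Win dominator first (start G)
  ¬𝒮⇒dominator-first ¬𝒮 with determined dominator (start G)
  ... | inj₁ w = w
  ... | inj₂ w = contradiction (toStrategy (second⇒first w) , toStrategy w) ¬𝒮

-- Joins with a single vertex.

-- The join of `H` with one vertex up to relabelling, so that one argument serves for `K₁` on either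
-- side of the join.
record IsCone (H K : Graph) : Set where
  field
    apex      : Vertex K
    embed     : Vertex H → Vertex K
    injective : ∀ {u v} → embed u ≡ embed v → u ≡ v
    apex≢     : ∀ v → apex ≢ embed v
    cover     : ∀ w → w ≡ apex ⊎ ∃ λ v → w ≡ embed v
    adj-embed : ∀ u v → Adj H u v ⇔ Adj K (embed u) (embed v)
    adj-apex  : ∀ v → Adj K apex (embed v)

someVertex : ∀ G → Vertex G
someVertex record { order = suc _ } = zero

module Cone {H K : Graph} (cone : IsCone H K) where
  open IsCone cone
  private
    module H = Play H
    module K = Play K
  open K using (Win; finished; move; answer)

  -- Links a position on `H` to one on `K` once Staller owns the apex. It is stated vertex by vertex
  -- because `embed` is an abstract map.
  record StallerApex (p : Position H) (q : Position K) : Set where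
    field
      at-apex  : K.ChosenBy staller q apex
      at-embed : ∀ v → lookup q (embed v) ≡ lookup p v
  open StallerApex

  choose-embed : ∀ {P v p q} → StallerApex p q → StallerApex (H.choose P v p) (K.choose P (embed v) q)
  choose-embed {v = v} {q = q} m .at-apex = K.choose-≢ q (apex≢ v) (at-apex m)
  choose-embed {P} {v} {p} {q} m .at-embed w with w ≟ v
  ... | yes refl = trans (K.chosen P (embed v) q) (sym (H.chosen P v p))
  ... | no w≢v   = trans (K.choose-≢ q (w≢v ∘ injective) (at-embed m w)) (sym (lookup∘update′ w≢v p _))

  dominating⁺ : ∀ {p q} → StallerApex p q → Dominating H (H.ChosenBy dominator p) →
    Dominating K (K.ChosenBy dominator q)
  dominating⁺ {p} {q} m d w with cover w
  ... | inj₂ (v , refl) = Sum.map (trans (at-embed m v))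
    (λ (u , c , a) → embed u , trans (at-embed m u) c , Equivalence.to (adj-embed u v) a) (d v)
  -- The apex is dominated by any vertex of Dominator in `H`. He owns one because `H` has a vertex
  -- and something must dominate it.
  ... | inj₁ refl = inj₂ (from-owned (owned (d (someVertex H))))
    where
    owned : ∀ {v} → H.ChosenBy dominator p v ⊎ (∃ λ u → H.ChosenBy dominator p u × Adj H u v) →
      ∃ (H.ChosenBy dominator p)
    owned (inj₁ c)           = _ , c
    owned (inj₂ (u , c , _)) = u , c
    from-owned : ∃ (H.ChosenBy dominator p) → ∃ λ u → K.ChosenBy dominator q u × Adj K u apex
    from-owned (u , c) = embed u , trans (at-embed m u) c , symm K (adj-apex u)

  dominating⁻ : ∀ {p q} → StallerApex p q → Dominating K (K.ChosenBy dominator q) →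
    Dominating H (H.ChosenBy dominator p)
  dominating⁻ m d v with d (embed v)
  ... | inj₁ c = inj₁ (trans (sym (at-embed m v)) c)
  ... | inj₂ (w , c , a) with cover w
  -- The dominating neighbour cannot be the apex, which belongs to Staller.
  ...   | inj₁ refl       = contradiction (trans (sym (at-apex m)) c) λ ()
  ...   | inj₂ (u , refl) =
    inj₂ (u , trans (sym (at-embed m u)) c , Equivalence.from (adj-embed u v) a)

  won : ∀ P {p q} → StallerApex p q → H.Won P p → K.Won P q
  won dominator m d    = dominating⁺ m d
  won staller   m ¬d d = ¬d (dominating⁻ m d)

  unchosen-embed : ∀ {p q w} → StallerApex p q → K.Unchosen q w →
    ∃ λ v → w ≡ embed v × H.Unchosen p v
  unchosen-embed {w = w} m u with cover w
  ... | inj₁ refl       = contradiction (trans (sym u) (at-apex m)) λ ()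
  ... | inj₂ (v , refl) = v , refl , trans (sym (at-embed m v)) u

  -- With the apex gone, legal moves on `K` and `H` correspond along `embed` and the results agree,
  -- so a strategy is copied move by move. It is applied to Staller for `𝒩` and to Dominator for
  -- `𝒟`.
  transfer : ∀ {P r p q} → StallerApex p q → H.Win P r p → Win P r q
  transfer {P} m (H.finished f w) =
    finished (λ v u → let (v′ , _ , u′) = unchosen-embed m u in f v′ u′) (won P m w)
  transfer m (H.move v u w) =
    move (embed v) (trans (at-embed m v) u) (transfer (choose-embed m) w)
  transfer {P} {q = q} m (H.answer (v , u) k) = answer (embed v , trans (at-embed m v) u) reply
    where
    reply : ∀ w → K.Unchosen q w → Win P first (K.choose (opponent P) w q)
    reply w uw with unchosen-embed m uw
    ... | v , refl , uv = transfer (choose-embed m) (k v uv)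

  staller-takes-apex : StallerApex (start H) (K.choose staller apex (start K))
  staller-takes-apex .at-apex    = K.chosen staller apex (start K)
  staller-takes-apex .at-embed v =
    trans (K.choose-≢ (start K) (≢-sym (apex≢ v)) (K.unchosen-start (embed v))) (sym (H.unchosen-start v))

  apex-dominates : ∀ p → K.ChosenBy dominator p apex → Dominating K (K.ChosenBy dominator p)
  apex-dominates p c w with cover w
  ... | inj₁ refl       = inj₁ c
  ... | inj₂ (v , refl) = inj₂ (apex , c , adj-apex v)

  take-apex : ∀ {p} → K.Unchosen p apex → Win dominator first p
  take-apex {p} u = move apex u
    (K.dominating⇒win second _ (apex-dominates (K.choose dominator apex p) (K.chosen dominator apex p)))

  outcome-𝒩 : HasOutcome H 𝒮 → HasOutcome K 𝒩
  outcome-𝒩 (_ , σ , w) = K.toStrategy (take-apex (K.unchosen-start apex)) ,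
    K.toStrategy (move apex (K.unchosen-start apex) (transfer staller-takes-apex (H.fromStrategy σ w)))

  outcome-𝒟 : ¬ HasOutcome H 𝒮 → HasOutcome K 𝒟
  outcome-𝒟 ¬𝒮 = K.toStrategy (take-apex (K.unchosen-start apex)) ,
    K.toStrategy (answer (apex , K.unchosen-start apex) reply)
    where
    reply : ∀ v → K.Unchosen (start K) v → Win dominator first (K.choose staller v (start K))
    reply w _ with cover w
    ... | inj₁ refl       = transfer staller-takes-apex (H.¬𝒮⇒dominator-first ¬𝒮)
    ... | inj₂ (v , refl) = take-apex (K.choose-≢ (start K) (apex≢ v) (K.unchosen-start apex))

-- Joins of two graphs with at least two vertices each.

-- Indexing the sides by `Bool` lets one argument treat both, with `not` giving the opposite side.
record IsThickJoin (K : Graph) : Set where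
  field
    side   : Vertex K → Bool
    across : ∀ u v → side u ≢ side v → Adj K u v
    pair   : ∀ b → ∃₂ λ x y → x ≢ y × side x ≡ b × side y ≡ b

module ThickJoin {K : Graph} (thick : IsThickJoin K) where
  open IsThickJoin thick
  open Play K

  -- One move of Staller cannot exhaust a side: of two distinct vertices, at most one is `w`.
  avoid : ∀ b w → ∃ λ z → z ≢ w × side z ≡ b
  avoid b w with pair b
  ... | x , y , x≢y , sx , sy with x ≟ w
  ...   | yes refl = y , ≢-sym x≢y , sy
  ...   | no x≢w   = x , x≢w , sx

  -- Every vertex lies opposite `u` or opposite `v`, hence is adjacent to one of them.
  both-sides-dominate : ∀ p u v → ChosenBy dominator p u → ChosenBy dominator p v →
    side u ≢ side v → Dominating K (ChosenBy dominator p)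
  both-sides-dominate p u v cu cv u≢v w with side u ≟ᵇ side w
  ... | no u≢w  = inj₂ (u , cu , across u w u≢w)
  ... | yes u≡w = inj₂ (v , cv , across v w λ v≡w → u≢v (trans u≡w (sym v≡w)))

  -- Staller can take only one vertex of the opposite side before Dominator moves again, and he then
  -- takes another one there.
  other-side-free⇒win : ∀ {p} u → ChosenBy dominator p u →
    (∀ v → side v ≡ not (side u) → Unchosen p v) → Win dominator second p
  other-side-free⇒win {p} u cu free = answer (z₀ , free z₀ s₀) reply
    where
    -- `z₀` only witnesses that the position is unfinished; avoiding `u` is an arbitrary choice.
    z₀ = proj₁ (avoid (not (side u)) u)
    s₀ = proj₂ (proj₂ (avoid (not (side u)) u))
    reply : ∀ w → Unchosen p w → Win dominator first (choose staller w p)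
    reply w uw with avoid (not (side u)) w
    ... | z , z≢w , sz = move z uz (dominating⇒win second _
        (both-sides-dominate (choose dominator z p′) u z
          (choose-keeps p′ uz (choose-keeps p uw cu)) (chosen dominator z p′)
          λ eq → not-¬ refl (trans eq sz)))
      where
      p′ = choose staller w p
      uz : Unchosen p′ z
      uz = choose-≢ p z≢w (free z sz)

  outcome-𝒟 : HasOutcome K 𝒟
  outcome-𝒟 = toStrategy (move x (unchosen-start x)
      (other-side-free⇒win x (chosen dominator x (start K))
        λ v sv → choose-≢ (start K) (λ { refl → not-¬ refl sv }) (unchosen-start v))) ,
    toStrategy (answer (x , unchosen-start x) reply)
    where
    x = proj₁ (pair true)
    reply : ∀ w → Unchosen (start K) w → Win dominator first (choose staller w (start K))
    -- Dominator answers on Staller's own side, which keeps the opposite side entirely free.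
    reply w _ with avoid (side w) w
    ... | z , z≢w , sz = move z (choose-≢ (start K) z≢w (unchosen-start z))
      (other-side-free⇒win z (chosen dominator z (choose staller w (start K))) λ v sv →
        choose-≢ (choose staller w (start K)) (λ { refl → not-¬ refl sv })
          (choose-≢ (start K) (λ { refl → not-¬ (sym sz) sv }) (unchosen-start v)))

-- One-vertex graphs and `K₁`.

Single : Graph → Set
Single G = Σ (Vertex G) λ c → ∀ v → v ≡ c

≅K₁⇒single : ∀ {G} → G ≅ K₁ → Single G
≅K₁⇒single iso = from zero , λ v → trans (sym (strictlyInverseʳ v)) (cong from (to-zero (to v)))
  where
  open Inverse (_≅_.bijection iso)
  to-zero : ∀ (i : Fin 1) → i ≡ zero
  to-zero zero = refl

single⇒≅K₁ : ∀ {G} → Single G → G ≅ K₁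
single⇒≅K₁ {G} (c , only) = record
  { bijection = mk↔ₛ′ (λ _ → zero) (λ _ → c) (λ { zero → refl }) (λ v → sym (only v))
  ; adjacency = λ u v → mk⇔ (irrefl G (trans (only u) (sym (only v)))) λ ()
  }

single-or-pair : ∀ G → Single G ⊎ ∃₂ λ (x y : Vertex G) → x ≢ y
single-or-pair record { order = suc zero }    = inj₁ (zero , λ { zero → refl })
single-or-pair record { order = suc (suc _) } = inj₂ (zero , suc zero , λ ())

-- The join as a cone or a thick join.

module _ (G H : Graph) where
  private
    m = order G
    n = order H

  -- A view of the vertices: matching on it turns a vertex into an explicit injection, as the
  -- `cover` proofs require.
  data Side : Vertex (G ⋈ H) → Set where
    left  : ∀ u → Side (u ↑ˡ n)
    right : ∀ v → Side (m ↑ʳ v)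

  sideOf : ∀ w → Side w
  sideOf w with splitAt m w in eq
  ... | inj₁ u = subst Side (splitAt⁻¹-↑ˡ eq) (left u)
  ... | inj₂ v = subst Side (splitAt⁻¹-↑ʳ eq) (right v)

  ↑ˡ≢↑ʳ : ∀ u v → u ↑ˡ n ≢ m ↑ʳ v
  ↑ˡ≢↑ʳ u v eq with trans (sym (splitAt-↑ˡ m u n)) (trans (cong (splitAt m) eq) (splitAt-↑ʳ m n v))
  ... | ()

  adj-left-right : ∀ u v → Adj (G ⋈ H) (u ↑ˡ n) (m ↑ʳ v)
  adj-left-right u v rewrite splitAt-↑ˡ m u n | splitAt-↑ʳ m n v = tt

  adj-left : ∀ u v → Adj G u v ⇔ Adj (G ⋈ H) (u ↑ˡ n) (v ↑ˡ n)
  adj-left u v rewrite splitAt-↑ˡ m u n | splitAt-↑ˡ m v n = ⇔-id _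

  adj-right : ∀ u v → Adj H u v ⇔ Adj (G ⋈ H) (m ↑ʳ u) (m ↑ʳ v)
  adj-right u v rewrite splitAt-↑ʳ m n u | splitAt-↑ʳ m n v = ⇔-id _

  cone-left : Single G → IsCone H (G ⋈ H)
  cone-left (c , only) = record
    { apex      = c ↑ˡ n
    ; embed     = m ↑ʳ_
    ; injective = ↑ʳ-injective m _ _
    ; apex≢     = ↑ˡ≢↑ʳ c
    ; cover     = λ w → cover (sideOf w)
    ; adj-embed = adj-right
    ; adj-apex  = adj-left-right c
    }
    where
    cover : ∀ {w} → Side w → w ≡ c ↑ˡ n ⊎ ∃ λ v → w ≡ m ↑ʳ v
    cover (left u)  = inj₁ (cong (_↑ˡ n) (only u))
    cover (right v) = inj₂ (v , refl)

  cone-right : Single H → IsCone G (G ⋈ H)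
  cone-right (c , only) = record
    { apex      = m ↑ʳ c
    ; embed     = _↑ˡ n
    ; injective = ↑ˡ-injective n _ _
    ; apex≢     = λ u → ≢-sym (↑ˡ≢↑ʳ u c)
    ; cover     = λ w → cover (sideOf w)
    ; adj-embed = adj-left
    ; adj-apex  = λ u → symm (G ⋈ H) {u ↑ˡ n} {m ↑ʳ c} (adj-left-right u c)
    }
    where
    cover : ∀ {w} → Side w → w ≡ m ↑ʳ c ⊎ ∃ λ u → w ≡ u ↑ˡ n
    cover (left u)  = inj₂ (u , refl)
    cover (right v) = inj₁ (cong (m ↑ʳ_) (only v))

  thick : (∃₂ λ (x y : Vertex G) → x ≢ y) → (∃₂ λ (x y : Vertex H) → x ≢ y) → IsThickJoin (G ⋈ H)
  thick (x , y , x≢y) (x′ , y′ , x′≢y′) = record { side = side ; across = across ; pair = pair }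
    where
    isLeft : Vertex G ⊎ Vertex H → Bool
    isLeft (inj₁ _) = true
    isLeft (inj₂ _) = false
    side : Vertex (G ⋈ H) → Bool
    side w = isLeft (splitAt m w)
    across : ∀ u v → side u ≢ side v → Adj (G ⋈ H) u v
    -- `side` and the adjacency of the join are computed from the same two `splitAt` terms, so
    -- abstracting these reduces both at once.
    across u v u≢v with splitAt m u | splitAt m v
    ... | inj₁ _ | inj₁ _ = contradiction refl u≢v
    ... | inj₁ _ | inj₂ _ = tt
    ... | inj₂ _ | inj₁ _ = tt
    ... | inj₂ _ | inj₂ _ = contradiction refl u≢v
    pair : ∀ b → ∃₂ λ x y → x ≢ y × side x ≡ b × side y ≡ b
    pair true  = x ↑ˡ n , y ↑ˡ n , x≢y ∘ ↑ˡ-injective n _ _ ,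
      cong isLeft (splitAt-↑ˡ m x n) , cong isLeft (splitAt-↑ˡ m y n)
    pair false = m ↑ʳ x′ , m ↑ʳ y′ , x′≢y′ ∘ ↑ʳ-injective m _ _ ,
      cong isLeft (splitAt-↑ʳ m n x′) , cong isLeft (splitAt-↑ʳ m n y′)

theorem5 : (G H : Graph) →
    (((G ≅ K₁ × HasOutcome H 𝒮) ⊎ (H ≅ K₁ × HasOutcome G 𝒮)) → HasOutcome (G ⋈ H) 𝒩)
    × (¬ ((G ≅ K₁ × HasOutcome H 𝒮) ⊎ (H ≅ K₁ × HasOutcome G 𝒮)) → HasOutcome (G ⋈ H) 𝒟)
theorem5 G H = exceptional , generic
  where
  exceptional : (G ≅ K₁ × HasOutcome H 𝒮) ⊎ (H ≅ K₁ × HasOutcome G 𝒮) → HasOutcome (G ⋈ H) 𝒩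
  exceptional (inj₁ (iso , s)) = Cone.outcome-𝒩 (cone-left G H (≅K₁⇒single iso)) s
  exceptional (inj₂ (iso , s)) = Cone.outcome-𝒩 (cone-right G H (≅K₁⇒single iso)) s

  generic : ¬ ((G ≅ K₁ × HasOutcome H 𝒮) ⊎ (H ≅ K₁ × HasOutcome G 𝒮)) → HasOutcome (G ⋈ H) 𝒟
  -- A one-vertex graph serves as the apex, `G` being preferred if both qualify; `¬exc` then
  -- excludes `𝒮` for the other graph.
  generic ¬exc with single-or-pair G | single-or-pair H
  ... | inj₁ s  | _       = Cone.outcome-𝒟 (cone-left G H s) λ h → ¬exc (inj₁ (single⇒≅K₁ s , h))
  ... | inj₂ _  | inj₁ s  = Cone.outcome-𝒟 (cone-right G H s) λ g → ¬exc (inj₂ (single⇒≅K₁ s , g))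
  ... | inj₂ pG | inj₂ pH = ThickJoin.outcome-𝒟 (thick G H pG pH)
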